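{- Let $n\ge 1$ and $0\leq k\leq n$ be integers. The number of parking functions of length $n$ with exactly $k$ fixed points is $$\frac{1}{(n+1)^2} \binom{n+1}{k} \left(n^{n-k+1}-(-1)^{n-k+1}\right).$$
   Context: A parking function of length $n$ is a sequence $\pi=(\pi_1,\dots,\pi_n)$ of positive integers such that, if $\lambda_1\le\cdots\le\lambda_n$ is the weakly increasing rearrangement of $\pi_1,\dots,\pi_n$, then $\lambda_i\le i$ for all $1\le i\le n$. An index $i\in\{1,\dots,n\}$ is a fixed point of $\pi$ if $\pi_i=i$. -}

module Defs where

open import Data.Fin.Base using (Fin; toℕ)
open import Data.List.Base as List using ()
open import Data.Nat.Base using (ℕ; suc; _≤_)
open import Data.Nat.Properties using (_≟_; ≤-decTotalOrder)
open import Data.List.Sort ≤-decTotalOrder using (sort)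
open import Data.Product.Base using (_×_)
open import Data.Refinement using (Refinement-syntax)
open import Data.Vec.Base using (Vec; lookup; toList; allFin; count)
open import Data.Vec.Relation.Unary.All using (All)
open import Relation.Binary.PropositionalEquality.Core using (_≡_)
open import Relation.Unary using (Decidable)

-- An element i of Fin n stands for the one-based index suc (toℕ i).

-- The list  sort (toList π)  is the weakly increasing rearrangement of π; it
-- is indexed by its own length, which equals n only propositionally.
IsParkingFunction : ∀ {n} → Vec ℕ n → Set
IsParkingFunction π =
  All (1 ≤_) π ×
  (∀ i → List.lookup (sort (toList π)) i ≤ suc (toℕ i))

FixedPoint : ∀ {n} → Vec ℕ n → Fin n → Set
FixedPoint π i = lookup π i ≡ suc (toℕ i)

fixedPoint? : ∀ {n} (π : Vec ℕ n) → Decidable (FixedPoint π)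
fixedPoint? π i = lookup π i ≟ suc (toℕ i)

#fixedPoints : ∀ {n} → Vec ℕ n → ℕ
#fixedPoints {n} π = count (fixedPoint? π) (allFin n)

-- The membership proof in a refinement is irrelevant, so elements with the
-- same underlying sequence are equal, and a bijection with Fin N counts
-- sequences rather than proofs.
ParkingFunctionWithFixedPoints : ℕ → ℕ → Set
ParkingFunctionWithFixedPoints n k =
  [ π ∈ Vec ℕ n ∣ IsParkingFunction π × #fixedPoints π ≡ k ]

{-# OPTIONS --safe #-}

-- Write N = n + 1 and let A k be the number of parking functions with k fixed
-- points.  The moment ∑ₖ A k · C(k, j) counts the parking functions with a
-- marked j-set of fixed points.  Since parking only depends on the multiset of
-- entries, these correspond to pairs of a j-subset S of {1, …, n} and a word w
-- of length n − j for which S ++ w is parking.  Letting S range over subsets of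
-- ℤ/N instead changes nothing (a parking function has no entry N) and makes the
-- set of all pairs (S, w) invariant under rotation of ℤ/N.  By the cycle lemma
-- exactly one of the N rotations of S ++ w is parking, so
--   N · ∑ₖ A k · C(k, j) = C(N, j) · N ^ (n − j).
-- By the binomial theorem the closed form, multiplied by N², has N² times these
-- moments, and the moments for j ≤ n determine A.

module Submission where

open import Defs
open import Data.Bool.Base using (if_then_else_)
open import Data.Empty using (⊥-elim-irr)
open import Data.Fin.Base using (Fin; zero; suc; toℕ; fromℕ; fromℕ<; inject₁)
open import Data.Fin.Induction using (<-weakInduction)
import Data.Fin.Properties as Fin
open import Data.Fin.Relation.Unary.Top using (view; ‵fromℕ; ‵inject₁)
open import Data.Integer.Base as ℤ using (ℤ; +_; 0ℤ; 1ℤ; -1ℤ)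
import Data.Integer.Properties as ℤ
open import Data.Integer.Tactic.RingSolver using () renaming (solve-∀ to solve-∀ℤ)
open import Data.Irrelevant using ([_])
open import Data.List.Base as List using (List; []; _∷_; _++_; length)
open import Data.List.Membership.Propositional.Properties using (∈-lookup)
import Data.List.Properties as List
open import Data.List.Relation.Binary.Permutation.Propositional as Perm
  using (_↭_; ↭-refl; ↭-trans; ↭-sym; prep; swap)
open import Data.List.Relation.Binary.Permutation.Propositional.Properties
  using (shift; map⁺; ++⁺ʳ; All-resp-↭; ↭-length)
import Data.List.Relation.Unary.All as List-All
import Data.List.Relation.Unary.All.Properties as List-All
open import Data.List.Relation.Unary.AllPairs using (AllPairs; _∷_)
open import Data.List.Relation.Unary.Sorted.TotalOrder.Properties using (Sorted⇒AllPairs)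
open import Data.Nat.Base hiding (_/_)
open import Data.Nat.Combinatorics
  using (_C_; nCk+nC[k+1]≡[n+1]C[k+1]; k>n⇒nCk≡0; nCn≡1)
open import Data.Nat.DivMod using (_%_; _mod_; [m+kn]%n≡m%n; m<n⇒m%n≡m; m%n<n)
open import Data.Nat.ListAction using () renaming (sum to sumList)
open import Data.Nat.ListAction.Properties using (sum-↭)
open import Data.Nat.Properties
open import Data.List.Sort ≤-decTotalOrder using (sort; sort-↭; sort-↗)
open import Data.Nat.Tactic.RingSolver using (solve-∀)
open import Data.Product.Base using (Σ; _×_; _,_; ∃-syntax; proj₁; proj₂)
open import Data.Product.Function.Dependent.Propositional using (Σ-↔)
open import Data.Rational.Base as ℚ using (_/_; toℚᵘ)
import Data.Rational.Properties as ℚ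
open import Data.Rational.Unnormalised.Base as ℚᵘ using (mkℚᵘ; *≡*)
import Data.Rational.Unnormalised.Properties as ℚᵘ
open import Data.Refinement using (Refinement; Refinement-syntax; _,_; value)
open import Data.Sum.Base using (inj₁; inj₂)
open import Data.Sum.Function.Propositional using (_⊎-↔_)
open import Data.Vec.Base as Vec using (Vec; []; _∷_; lookup; toList)
import Data.Vec.Properties as Vec
open import Data.Vec.Relation.Unary.All as All using (All; []; _∷_)
import Data.Vec.Relation.Unary.All.Properties as All
open import Function.Base using (_∘_; id)
open import Function.Bundles using (_↔_; mk⇔; mk↔ₛ′)
open import Function.Definitions using (Injective)
open import Function.Properties.Inverse using (↔-refl; ↔-sym; ↔-trans)
open import Relation.Binary.PropositionalEquality
open import Relation.Nullary.Decidable
  using (Dec; yes; no; does; does-⇔; dec-true; dec-false; _×-dec_; recompute)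
open import Relation.Nullary.Negation using (¬_; contradiction)
open import Relation.Unary using (Decidable)

open import Algebra.Properties.Semiring.Sum +-*-semiring
  using (sum; sum-cong-≗; sum-init-last; sum-replicate-zero; ∑-comm; ∑-distrib-+; *-distribˡ-sum)
import Algebra.Properties.Semiring.Sum ℤ.+-*-semiring as ℤSum

open ≡-Reasoning

-- Sums over words and over subsets

𝟙 : ∀ {P : Set} → Dec P → ℕ
𝟙 p = if does p then 1 else 0

𝟙-cong : ∀ {P Q : Set} (p : Dec P) (q : Dec Q) → (P → Q) → (Q → P) → 𝟙 p ≡ 𝟙 q
𝟙-cong p q f g = cong (if_then 1 else 0) (does-⇔ (mk⇔ f g) p q)

𝟙-true : ∀ {P : Set} (p : Dec P) → P → 𝟙 p ≡ 1
𝟙-true p x = cong (if_then 1 else 0) (dec-true p x)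

𝟙-false : ∀ {P : Set} (p : Dec P) → ¬ P → 𝟙 p ≡ 0
𝟙-false p x = cong (if_then 1 else 0) (dec-false p x)

𝟙≤1 : ∀ {P : Set} (p : Dec P) → 𝟙 p ≤ 1
𝟙≤1 (yes _) = ≤-refl
𝟙≤1 (no _)  = z≤n

𝟙-× : ∀ {P Q : Set} (p : Dec P) (q : Dec Q) → 𝟙 (p ×-dec q) ≡ 𝟙 p * 𝟙 q
𝟙-× (yes _) (yes _) = refl
𝟙-× (yes _) (no _)  = refl
𝟙-× (no _)  _       = refl

sum-const : ∀ n c → sum {n} (λ _ → c) ≡ n * c
sum-const zero    c = refl
sum-const (suc n) c = cong (_+_ c) (sum-const n c)

sum-𝟙 : ∀ {n} (p : Fin n) (f : Fin n → ℕ) → sum (λ x → 𝟙 (x Fin.≟ p) * f x) ≡ f p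
sum-𝟙 {suc n} zero f = begin
  f zero + 0 + sum (λ x → 𝟙 (suc x Fin.≟ zero) * f (suc x))
    ≡⟨ cong₂ _+_ (+-identityʳ _) (sum-cong-≗ λ x → cong (_* f (suc x)) (𝟙-false (suc x Fin.≟ zero) λ ())) ⟩
  f zero + sum {n} (λ _ → 0)  ≡⟨ cong (_+_ (f zero)) (sum-replicate-zero n) ⟩
  f zero + 0                  ≡⟨ +-identityʳ _ ⟩
  f zero                      ∎
sum-𝟙 (suc p) f = trans
  (sum-cong-≗ λ x → cong (_* f (suc x)) (𝟙-cong (suc x Fin.≟ suc p) (x Fin.≟ p) Fin.suc-injective (cong suc)))
  (sum-𝟙 p (f ∘ suc))

∑words : ∀ {N} m → (Vec (Fin N) m → ℕ) → ℕ
∑words zero    f = f []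
∑words (suc m) f = sum λ x → ∑words m (f ∘ (x ∷_))

∑words-cong : ∀ {N} m {f g : Vec (Fin N) m → ℕ} → (∀ w → f w ≡ g w) → ∑words m f ≡ ∑words m g
∑words-cong zero    f≗g = f≗g []
∑words-cong (suc m) f≗g = sum-cong-≗ λ x → ∑words-cong m (f≗g ∘ (x ∷_))

∑words-∑ : ∀ {N M} m (f : Fin M → Vec (Fin N) m → ℕ) →
  ∑words m (λ w → sum λ i → f i w) ≡ sum λ i → ∑words m (f i)
∑words-∑ zero    f = refl
∑words-∑ (suc m) f = trans
  (sum-cong-≗ λ x → ∑words-∑ m λ i → f i ∘ (x ∷_))
  (∑-comm λ x i → ∑words m (f i ∘ (x ∷_)))

∑words-+ : ∀ {N} m (f g : Vec (Fin N) m → ℕ) →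
  ∑words m (λ w → f w + g w) ≡ ∑words m f + ∑words m g
∑words-+ zero    f g = refl
∑words-+ (suc m) f g = trans
  (sum-cong-≗ λ x → ∑words-+ m (f ∘ (x ∷_)) (g ∘ (x ∷_)))
  (∑-distrib-+ (λ x → ∑words m (f ∘ (x ∷_))) (λ x → ∑words m (g ∘ (x ∷_))))

∑words-* : ∀ {N} m c (f : Vec (Fin N) m → ℕ) → ∑words m (λ w → c * f w) ≡ c * ∑words m f
∑words-* zero    c f = refl
∑words-* (suc m) c f = trans
  (sum-cong-≗ λ x → ∑words-* m c (f ∘ (x ∷_)))
  (sym (*-distribˡ-sum c λ x → ∑words m (f ∘ (x ∷_))))

∑words-const : ∀ {N} m → ∑words {N} m (λ _ → 1) ≡ N ^ m
∑words-const zero        = refl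
∑words-const {N} (suc m) = trans (sum-const N _) (cong (N *_) (∑words-const m))

∑words-zero : ∀ {N} m → ∑words {N} m (λ _ → 0) ≡ 0
∑words-zero m = ∑words-* m 0 (λ _ → 0)

-- Choices are made by position and keep the order of the list. The last clause separates the
-- choices without and with the head, so Pascal's rule gives their number.
∑combos : ∀ {A : Set} → ℕ → List A → (List A → ℕ) → ℕ
∑combos zero    xs       f = f []
∑combos (suc j) []       f = 0
∑combos (suc j) (x ∷ xs) f = ∑combos (suc j) xs f + ∑combos j xs (f ∘ (x ∷_))

∑combos-cong : ∀ {A : Set} j (xs : List A) {f g} → (∀ S → length S ≡ j → f S ≡ g S) →
  ∑combos j xs f ≡ ∑combos j xs g
∑combos-cong zero    xs       f≗g = f≗g [] refl
∑combos-cong (suc j) []       f≗g = refl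
∑combos-cong (suc j) (x ∷ xs) f≗g = cong₂ _+_
  (∑combos-cong (suc j) xs f≗g)
  (∑combos-cong j xs λ S ∣S∣ → f≗g (x ∷ S) (cong suc ∣S∣))

∑combos-∑ : ∀ {A : Set} {M} j (xs : List A) (f : Fin M → List A → ℕ) →
  ∑combos j xs (λ S → sum λ i → f i S) ≡ sum λ i → ∑combos j xs (f i)
∑combos-∑     zero    xs       f = refl
∑combos-∑ {M = M} (suc j) [] f = sym (sum-replicate-zero M)
∑combos-∑     (suc j) (x ∷ xs) f = trans
  (cong₂ _+_ (∑combos-∑ (suc j) xs f) (∑combos-∑ j xs λ i → f i ∘ (x ∷_)))
  (sym (∑-distrib-+ (λ i → ∑combos (suc j) xs (f i)) (λ i → ∑combos j xs (f i ∘ (x ∷_)))))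

∑combos-const : ∀ {A : Set} j (xs : List A) c → ∑combos j xs (λ _ → c) ≡ (length xs C j) * c
∑combos-const zero    xs       c = sym (+-identityʳ c)
∑combos-const (suc j) []       c = refl
∑combos-const (suc j) (x ∷ xs) c = begin
  ∑combos (suc j) xs (λ _ → c) + ∑combos j xs (λ _ → c)
    ≡⟨ cong₂ _+_ (∑combos-const (suc j) xs c) (∑combos-const j xs c) ⟩
  (l C suc j) * c + (l C j) * c  ≡⟨ *-distribʳ-+ c (l C suc j) (l C j) ⟨
  (l C suc j + l C j) * c        ≡⟨ cong (_* c) (+-comm (l C suc j) (l C j)) ⟩
  (l C j + l C suc j) * c        ≡⟨ cong (_* c) (nCk+nC[k+1]≡[n+1]C[k+1] l j) ⟩
  (suc l C suc j) * c            ∎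
  where l = length xs

∑combos-zero : ∀ {A : Set} j (xs : List A) → ∑combos j xs (λ _ → 0) ≡ 0
∑combos-zero j xs = trans (∑combos-const j xs 0) (*-zeroʳ (length xs C j))

∑combos-short : ∀ {A : Set} j (xs : List A) f → length xs < j → ∑combos j xs f ≡ 0
∑combos-short (suc j) []       f _         = refl
∑combos-short (suc j) (x ∷ xs) f (s≤s l<j) = cong₂ _+_
  (∑combos-short (suc j) xs f (m<n⇒m<1+n l<j)) (∑combos-short j xs _ l<j)

∑combos-map : ∀ {A B : Set} (g : A → B) j xs f →
  ∑combos j (List.map g xs) f ≡ ∑combos j xs (f ∘ List.map g)
∑combos-map g zero    xs       f = refl
∑combos-map g (suc j) []       f = refl
∑combos-map g (suc j) (x ∷ xs) f = cong₂ _+_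
  (∑combos-map g (suc j) xs f) (∑combos-map g j xs (f ∘ (g x ∷_)))

Symmetric : ∀ {A : Set} → (List A → ℕ) → Set
Symmetric f = ∀ {xs ys} → xs ↭ ys → f xs ≡ f ys

-- When two neighbours are swapped, choices containing exactly one of them trade places, and those
-- containing both list them in opposite orders, which `f` does not see.
∑combos-↭ : ∀ {A : Set} j {xs ys : List A} f → Symmetric f → xs ↭ ys → ∑combos j xs f ≡ ∑combos j ys f
∑combos-↭ j f sym-f Perm.refl = refl
∑combos-↭ zero f sym-f (prep x p) = refl
∑combos-↭ (suc j) f sym-f (prep x p) = cong₂ _+_
  (∑combos-↭ (suc j) f sym-f p) (∑combos-↭ j _ (sym-f ∘ prep x) p)
∑combos-↭ zero f sym-f (swap x y p) = refl
-- A single choice cannot contain both swapped entries, so the fourth term is missing.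
∑combos-↭ (suc zero) {ys = _ ∷ _ ∷ zs} f sym-f (swap x y p) = trans
  (cong (λ s → s + f (y ∷ []) + f (x ∷ [])) (∑combos-↭ 1 f sym-f p))
  (lemma (∑combos 1 zs f) (f (y ∷ [])) (f (x ∷ [])))
  where
  lemma : ∀ a b c → a + b + c ≡ a + c + b
  lemma = solve-∀
∑combos-↭ (suc (suc j)) {_ ∷ _ ∷ ws} {_ ∷ _ ∷ zs} f sym-f (swap x y p) = begin
  ∑combos (2+ j) ws f + ∑combos (suc j) ws (f ∘ (y ∷_)) +
    (∑combos (suc j) ws (f ∘ (x ∷_)) + ∑combos j ws (f ∘ (x ∷_) ∘ (y ∷_)))
    ≡⟨ cong₂ _+_
        (cong₂ _+_ (∑combos-↭ (2+ j) f sym-f p) (∑combos-↭ (suc j) _ (sym-f ∘ prep y) p))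
        (cong₂ _+_ (∑combos-↭ (suc j) _ (sym-f ∘ prep x) p)
          (trans (∑combos-↭ j _ (sym-f ∘ prep x ∘ prep y) p)
            (∑combos-cong j zs λ S _ → sym-f (swap x y ↭-refl)))) ⟩
  ∑combos (2+ j) zs f + ∑combos (suc j) zs (f ∘ (y ∷_)) +
    (∑combos (suc j) zs (f ∘ (x ∷_)) + ∑combos j zs (f ∘ (y ∷_) ∘ (x ∷_)))
    ≡⟨ lemma (∑combos (2+ j) zs f) _ _ _ ⟩
  ∑combos (2+ j) zs f + ∑combos (suc j) zs (f ∘ (x ∷_)) +
    (∑combos (suc j) zs (f ∘ (y ∷_)) + ∑combos j zs (f ∘ (y ∷_) ∘ (x ∷_))) ∎
  where
  lemma : ∀ a b c d → a + b + (c + d) ≡ a + c + (b + d)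
  lemma = solve-∀
∑combos-↭ j f sym-f (Perm.trans p q) = trans (∑combos-↭ j f sym-f p) (∑combos-↭ j f sym-f q)

-- For `f = id` the right side is also `List.tabulate rotate`, so rotation permutes the residues. It
-- also isolates `fromℕ n`, the residue that no parking function takes.
tabulate-last-first : ∀ {A : Set} n (f : Fin (suc n) → A) →
  List.tabulate f ↭ f (fromℕ n) ∷ List.tabulate (f ∘ inject₁)
tabulate-last-first zero    f = ↭-refl
tabulate-last-first (suc n) f = ↭-trans
  (prep _ (tabulate-last-first n (f ∘ suc)))
  (swap _ _ ↭-refl)

-- Fixed points are the case `p = inject₁`; a general `p` allows the induction in `expand` to drop
-- the first position.
hits : ∀ {N m} → (Fin m → Fin N) → Vec (Fin N) m → ℕ
hits p w = sum λ i → 𝟙 (lookup w i Fin.≟ p i)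

hits≤ : ∀ {N m} (p : Fin m → Fin N) w → hits p w ≤ m
hits≤ p []      = z≤n
hits≤ p (x ∷ w) = +-mono-≤ (𝟙≤1 (x Fin.≟ p zero)) (hits≤ (p ∘ suc) w)

-- A marked set either avoids the first position or contains it, and the latter requires an
-- agreement there.
pascal-𝟙 : ∀ {P : Set} (p : Dec P) h j → (𝟙 p + h) C suc j ≡ h C suc j + 𝟙 p * (h C j)
pascal-𝟙 (yes _) h j = begin
  suc h C suc j                ≡⟨ nCk+nC[k+1]≡[n+1]C[k+1] h j ⟨
  h C j + h C suc j            ≡⟨ +-comm (h C j) _ ⟩
  h C suc j + h C j            ≡⟨ cong (_+_ (h C suc j)) (+-identityʳ (h C j)) ⟨
  h C suc j + (h C j + 0)      ∎
pascal-𝟙 (no _) h j = sym (+-identityʳ _)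

-- Moved past `S`, the letter `x` becomes the first letter of the free word.
∑words-symmetric-head : ∀ {N} (S : List (Fin N)) r G → Symmetric G →
  sum (λ x → ∑words r (λ w → G (x ∷ S ++ toList w))) ≡ ∑words (suc r) (λ w → G (S ++ toList w))
∑words-symmetric-head S r G sym-G =
  sum-cong-≗ λ x → ∑words-cong r λ w → sym-G (↭-sym (shift x S (toList w)))

-- The factor hits p v C j marks a j-set of positions where v agrees with p; the
-- marked entries form S, the others w.
expand : ∀ {N m} (p : Fin m → Fin N) j r G → Symmetric G → j + r ≡ m →
  ∑words m (λ v → (hits p v C j) * G (toList v)) ≡
  ∑combos j (List.tabulate p) (λ S → ∑words r (λ w → G (S ++ toList w)))
expand {m = m} p zero r G sym-G refl = ∑words-cong m λ v → +-identityʳ _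
expand {N} {suc m} p (suc j) r G sym-G eq = begin
  sum (λ x → ∑words m λ v → ((𝟙 (x Fin.≟ p zero) + hits p′ v) C suc j) * G (x ∷ toList v))
    ≡⟨ sum-cong-≗ (λ x → trans (∑words-cong m (λ v → trans
         (cong (_* G (x ∷ toList v)) (pascal-𝟙 (x Fin.≟ p zero) (hits p′ v) j))
         (distr (hits p′ v C suc j) (𝟙 (x Fin.≟ p zero)) (hits p′ v C j) (G (x ∷ toList v)))))
       (trans (∑words-+ m _ _) (cong (_+_ (free x)) (∑words-* m (𝟙 (x Fin.≟ p zero)) _)))) ⟩
  sum (λ x → free x + 𝟙 (x Fin.≟ p zero) * forced x)
    ≡⟨ ∑-distrib-+ free (λ x → 𝟙 (x Fin.≟ p zero) * forced x) ⟩
  sum free + sum (λ x → 𝟙 (x Fin.≟ p zero) * forced x)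
    ≡⟨ cong₂ _+_ (free≡ r eq) (trans (sum-𝟙 (p zero) forced)
         (expand p′ j r (G ∘ (p zero ∷_)) (sym-G ∘ prep _) (suc-injective eq))) ⟩
  ∑combos (suc j) (List.tabulate p′) (λ S → ∑words r (λ w → G (S ++ toList w))) +
  ∑combos j (List.tabulate p′) (λ S → ∑words r (λ w → G (p zero ∷ S ++ toList w))) ∎
  where
  p′ = p ∘ suc

  -- In `free` the first position is unmarked; in `forced` it is marked, so only `x = p zero`
  -- survives.
  free forced : Fin N → ℕ
  free   x = ∑words m λ v → (hits p′ v C suc j) * G (x ∷ toList v)
  forced x = ∑words m λ v → (hits p′ v C j) * G (x ∷ toList v)

  distr : ∀ a b c d → (a + b * c) * d ≡ a * d + b * (c * d)
  distr = solve-∀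

  free≡ : ∀ r → suc (j + r) ≡ suc m → sum free ≡
    ∑combos (suc j) (List.tabulate p′) (λ S → ∑words r (λ w → G (S ++ toList w)))
  -- Here `m = j`, so `suc j` marks do not fit into the remaining positions and both sides are zero.
  free≡ zero eq = begin
    sum free                ≡⟨ sum-cong-≗ (λ x → trans
                                 (∑words-cong m λ v → cong (_* G (x ∷ toList v)) (k>n⇒nCk≡0
                                   (≤-<-trans (hits≤ p′ v) m<1+j)))
                                 (∑words-zero {N} m)) ⟩
    sum {N} (λ _ → 0)       ≡⟨ sum-replicate-zero N ⟩
    0                       ≡⟨ ∑combos-short (suc j) (List.tabulate p′) _
                                 (≤-<-trans (≤-reflexive (List.length-tabulate p′)) m<1+j) ⟨
    _                       ∎
    where
    m<1+j : m < suc j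
    m<1+j = ≤-reflexive (trans (sym eq) (cong suc (+-identityʳ j)))
  free≡ (suc r) eq = begin
    sum free
      ≡⟨ sum-cong-≗ (λ x → expand p′ (suc j) r (G ∘ (x ∷_)) (sym-G ∘ prep x)
           (trans (sym (+-suc j r)) (suc-injective eq))) ⟩
    sum (λ x → ∑combos (suc j) (List.tabulate p′) (λ S → ∑words r (λ w → G (x ∷ S ++ toList w))))
      ≡⟨ ∑combos-∑ (suc j) (List.tabulate p′) (λ x S → ∑words r (λ w → G (x ∷ S ++ toList w))) ⟨
    ∑combos (suc j) (List.tabulate p′) (λ S → sum (λ x → ∑words r (λ w → G (x ∷ S ++ toList w))))
      ≡⟨ ∑combos-cong (suc j) (List.tabulate p′) (λ S _ → ∑words-symmetric-head S r G sym-G) ⟩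
    ∑combos (suc j) (List.tabulate p′) (λ S → ∑words (suc r) (λ w → G (S ++ toList w))) ∎

-- The cycle lemma

IsArgmin : ∀ {n} → (Fin n → ℕ) → Fin n → Set
IsArgmin H s = ∀ t → H s ≤ H t

isArgmin? : ∀ {n} (H : Fin n → ℕ) s → Dec (IsArgmin H s)
isArgmin? H s = Fin.all? λ t → H s ≤? H t

argmin : ∀ {n} (H : Fin (suc n) → ℕ) → ∃[ s ] IsArgmin H s
argmin {zero}  H = zero , λ { zero → ≤-refl }
argmin {suc n} H with argmin (H ∘ suc)
... | s , min with ≤-total (H zero) (H (suc s))
...   | inj₁ H0≤ = zero , λ { zero → ≤-refl ; (suc t) → ≤-trans H0≤ (min t) }
...   | inj₂ ≤H0 = suc s , λ { zero → ≤H0 ; (suc t) → min t }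

sum-argmin : ∀ {n} (H : Fin (suc n) → ℕ) → Injective _≡_ _≡_ H → sum (λ s → 𝟙 (isArgmin? H s)) ≡ 1
sum-argmin H inj with argmin H
... | s , min = trans
  (sum-cong-≗ λ t → trans
    (𝟙-cong (isArgmin? H t) (t Fin.≟ s) (λ min′ → inj (≤-antisym (min′ s) (min t))) λ { refl → min })
    (sym (*-identityʳ _)))
  (sum-𝟙 s λ _ → 1)

below : ∀ {N} → ℕ → List (Fin N) → ℕ
below m L = sumList (List.map (λ x → 𝟙 (toℕ x <? m)) L)

below-↭ : ∀ {N} m {L M : List (Fin N)} → L ↭ M → below m L ≡ below m M
below-↭ m p = sum-↭ (map⁺ _ p)

below-all : ∀ {N} (L : List (Fin N)) → below N L ≡ length L
below-all []      = refl
below-all (x ∷ L) = cong₂ _+_ (𝟙-true (toℕ x <? _) (Fin.toℕ<n x)) (below-all L)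

below-zero : ∀ {N} (L : List (Fin N)) → below 0 L ≡ 0
below-zero []      = refl
below-zero (x ∷ L) = below-zero L

-- Subtraction of one in ℤ/(n + 1).
rotate : ∀ {n} → Fin (suc n) → Fin (suc n)
rotate {n} zero = fromℕ n
rotate (suc v)  = inject₁ v

rotate-surjective : ∀ {n} (v : Fin (suc n)) → ∃[ u ] rotate u ≡ v
rotate-surjective v with view v
... | ‵fromℕ     = zero , refl
... | ‵inject₁ u = suc u , refl

-- Residues 1 to m move to 0 to m - 1, while the zeros, counted by `below 1 L`, move to n, which is
-- not below m.
below-rotate : ∀ {n} m (L : List (Fin (suc n))) → m ≤ n →
  below m (List.map rotate L) + below 1 L ≡ below (suc m) L
below-rotate m [] m≤n = refl
below-rotate {n} m (zero ∷ L) m≤n = begin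
  𝟙 (toℕ (fromℕ n) <? m) + below m (List.map rotate L) + (1 + below 1 L)
    ≡⟨ cong (λ s → s + below m (List.map rotate L) + (1 + below 1 L))
         (𝟙-false (toℕ (fromℕ n) <? m) (≤⇒≯ (≤-trans m≤n (≤-reflexive (sym (Fin.toℕ-fromℕ n)))))) ⟩
  below m (List.map rotate L) + (1 + below 1 L)  ≡⟨ +-suc _ _ ⟩
  1 + (below m (List.map rotate L) + below 1 L)  ≡⟨ cong suc (below-rotate m L m≤n) ⟩
  1 + below (suc m) L                            ∎
below-rotate m (suc x ∷ L) m≤n = begin
  𝟙 (toℕ (inject₁ x) <? m) + below m (List.map rotate L) + below 1 L
    ≡⟨ +-assoc (𝟙 (toℕ (inject₁ x) <? m)) _ _ ⟩
  𝟙 (toℕ (inject₁ x) <? m) + (below m (List.map rotate L) + below 1 L)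
    ≡⟨ cong₂ _+_ (cong (λ y → 𝟙 (y <? m)) (Fin.toℕ-inject₁ x)) (below-rotate m L m≤n) ⟩
  𝟙 (toℕ x <? m) + below (suc m) L ∎

-- The walk m ↦ below m L − m shifted by n to be nonnegative; appending toℕ v as a
-- digit in base n + 1 breaks ties in favour of the first minimum, and turns
-- rotation into a constant shift of the heights.
height : ∀ {n} → List (Fin (suc n)) → Fin (suc n) → ℕ
height {n} L v = toℕ v + (below (toℕ v) L + (n ∸ toℕ v)) * suc n

height-injective : ∀ {n} (L : List (Fin (suc n))) → Injective _≡_ _≡_ (height L)
height-injective {n} L {u} {v} eq = Fin.toℕ-injective (begin
  toℕ u               ≡⟨ height-% u ⟨
  height L u % suc n  ≡⟨ cong (_% suc n) eq ⟩
  height L v % suc n  ≡⟨ height-% v ⟩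
  toℕ v               ∎)
  where
  height-% : ∀ v → height L v % suc n ≡ toℕ v
  height-% v = trans ([m+kn]%n≡m%n (toℕ v) (below (toℕ v) L + (n ∸ toℕ v)) (suc n)) (m<n⇒m%n≡m (Fin.toℕ<n v))

-- The shift is the same for every `v`, even where `zero` wraps round to n: as `L` has n entries,
-- the walk falls by one over a full turn, worth n + 1 in height, and the digit gains n + 1.
height-rotate : ∀ {n} (L : List (Fin (suc n))) → length L ≡ n → ∀ v →
  height (List.map rotate L) (rotate v) + (below 1 L * suc n + 1) ≡ height L v + suc n
height-rotate {n} L ∣L∣ zero rewrite Fin.toℕ-fromℕ n | n∸n≡0 n | below-zero L = begin
  n + (below n (List.map rotate L) + 0) * suc n + (below 1 L * suc n + 1)
    ≡⟨ lemma n (below n (List.map rotate L)) (below 1 L) ⟩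
  (below n (List.map rotate L) + below 1 L) * suc n + suc n
    ≡⟨ cong (λ s → s * suc n + suc n) (trans (below-rotate n L ≤-refl) (trans (below-all L) ∣L∣)) ⟩
  n * suc n + suc n ∎
  where
  lemma : ∀ n a b → n + (a + 0) * suc n + (b * suc n + 1) ≡ (a + b) * suc n + suc n
  lemma = solve-∀
height-rotate {suc n} L ∣L∣ (suc v) rewrite Fin.toℕ-inject₁ v = begin
  toℕ v + (below (toℕ v) (List.map rotate L) + (suc n ∸ toℕ v)) * (2+ n) + (below 1 L * 2+ n + 1)
    ≡⟨ cong (λ d → toℕ v + (below (toℕ v) (List.map rotate L) + d) * 2+ n + (below 1 L * 2+ n + 1))
         (+-∸-assoc 1 (Fin.toℕ≤pred[n] v)) ⟩
  toℕ v + (below (toℕ v) (List.map rotate L) + suc (n ∸ toℕ v)) * (2+ n) + (below 1 L * 2+ n + 1)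
    ≡⟨ lemma (2+ n) (toℕ v) (below (toℕ v) (List.map rotate L)) (n ∸ toℕ v) (below 1 L) ⟩
  suc (toℕ v) + ((below (toℕ v) (List.map rotate L) + below 1 L) + (n ∸ toℕ v)) * 2+ n + 2+ n
    ≡⟨ cong (λ s → suc (toℕ v) + (s + (n ∸ toℕ v)) * 2+ n + 2+ n)
         (below-rotate (toℕ v) L (<⇒≤ (Fin.toℕ<n v))) ⟩
  suc (toℕ v) + (below (suc (toℕ v)) L + (n ∸ toℕ v)) * 2+ n + 2+ n ∎
  where
  lemma : ∀ N v a d b → v + (a + suc d) * N + (b * N + 1) ≡ suc v + ((a + b) + d) * N + N
  lemma = solve-∀

-- A constant shift of all heights preserves comparisons, and surjectivity of `rotate` ensures that
-- every index is compared.
argmin-rotate : ∀ {n} (L : List (Fin (suc n))) → length L ≡ n → ∀ v →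
  𝟙 (isArgmin? (height (List.map rotate L)) (rotate v)) ≡ 𝟙 (isArgmin? (height L) v)
argmin-rotate {n} L ∣L∣ v = 𝟙-cong (isArgmin? H′ (rotate v)) (isArgmin? H v)
  (λ min t → +-cancelʳ-≤ (suc n) (H v) (H t)
    (subst₂ _≤_ (height-rotate L ∣L∣ v) (height-rotate L ∣L∣ t) (+-monoˡ-≤ shift₁ (min (rotate t)))))
  back
  where
  H  = height L
  H′ = height (List.map rotate L)
  shift₁ = below 1 L * suc n + 1

  back : IsArgmin H v → IsArgmin H′ (rotate v)
  back min t with rotate-surjective t
  ... | u , refl = +-cancelʳ-≤ shift₁ (H′ (rotate v)) (H′ (rotate u))
    (subst₂ _≤_ (sym (height-rotate L ∣L∣ v)) (sym (height-rotate L ∣L∣ u)) (+-monoˡ-≤ (suc n) (min u)))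

-- A minimum at zero means that the walk never falls below its start: `m ≤ below m L` for all
-- `m ≤ n`, the counting form of the parking condition. The two lemmas below prove this equivalence.
Parking : ∀ {n} → List (Fin (suc n)) → Set
Parking L = IsArgmin (height L) zero

parking? : ∀ {n} (L : List (Fin (suc n))) → Dec (Parking L)
parking? L = isArgmin? (height L) zero

parking⇒below : ∀ {n} (L : List (Fin (suc n))) → Parking L → ∀ m → m ≤ n → m ≤ below m L
parking⇒below {n} L park m m≤n = +-cancelʳ-≤ (n ∸ m) m (below m L)
  (subst (_≤ below m L + (n ∸ m)) (sym (m+[n∸m]≡n m≤n)) n≤)
  where
  v = fromℕ< (s≤s m≤n)
  toℕ-v : toℕ v ≡ m
  toℕ-v = Fin.toℕ-fromℕ< (s≤s m≤n)
  n≤ : n ≤ below m L + (n ∸ m)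
  -- The tie-breaking digit `m` is smaller than the base `suc n`, so comparing heights compares the
  -- walk itself.
  n≤ = m<1+n⇒m≤n (*-cancelʳ-< (suc n) n (suc (below m L + (n ∸ m)))
    (≤-<-trans (subst₂ _≤_ (cong (λ s → (s + n) * suc n) (below-zero L))
       (cong (λ m → m + (below m L + (n ∸ m)) * suc n) toℕ-v) (park v))
      (+-monoˡ-< _ (s≤s m≤n))))

below⇒parking : ∀ {n} (L : List (Fin (suc n))) → (∀ m → m ≤ n → m ≤ below m L) → Parking L
below⇒parking {n} L enough t = subst (λ s → (s + n) * suc n ≤ height L t) (sym (below-zero L))
  (≤-trans (*-monoˡ-≤ (suc n) n≤) (m≤n+m _ (toℕ t)))
  where
  t≤n = Fin.toℕ≤pred[n] t
  n≤ : n ≤ below (toℕ t) L + (n ∸ toℕ t)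
  n≤ = subst (_≤ below (toℕ t) L + (n ∸ toℕ t)) (m+[n∸m]≡n t≤n) (+-monoˡ-≤ (n ∸ toℕ t) (enough (toℕ t) t≤n))

symmetric-argmin : ∀ {n} (v : Fin (suc n)) → Symmetric λ L → 𝟙 (isArgmin? (height L) v)
symmetric-argmin {n} v {L} {M} L↭M = 𝟙-cong (isArgmin? (height L) v) (isArgmin? (height M) v)
  (λ min t → subst₂ _≤_ (height-↭ v) (height-↭ t) (min t))
  (λ min t → subst₂ _≤_ (sym (height-↭ v)) (sym (height-↭ t)) (min t))
  where
  height-↭ : ∀ t → height L t ≡ height M t
  height-↭ t = cong (λ b → toℕ t + (b + (n ∸ toℕ t)) * suc n) (below-↭ (toℕ t) L↭M)

-- Averaging over the rotations

∑pairs : ∀ {n} → ℕ → ℕ → (List (Fin (suc n)) → ℕ) → ℕ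
∑pairs j r f = ∑combos j (List.tabulate id) λ S → ∑words r λ w → f (S ++ toList w)

∑pairs-cong : ∀ {n} j r {f g : List (Fin (suc n)) → ℕ} → (∀ L → length L ≡ j + r → f L ≡ g L) →
  ∑pairs j r f ≡ ∑pairs j r g
∑pairs-cong j r f≗g = ∑combos-cong j _ λ S ∣S∣ → ∑words-cong r λ w →
  f≗g (S ++ toList w) (trans (List.length-++ S) (cong₂ _+_ ∣S∣ (Vec.length-toList w)))

sum-rotate : ∀ {n} (f : Fin (suc n) → ℕ) → sum (f ∘ rotate) ≡ sum f
sum-rotate {n} f = trans (+-comm (f (fromℕ n)) _) (sym (sum-init-last f))

∑words-rotate : ∀ {n} r (f : Vec (Fin (suc n)) r → ℕ) → ∑words r (f ∘ Vec.map rotate) ≡ ∑words r f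
∑words-rotate zero    f = refl
∑words-rotate (suc r) f = trans
  (sum-cong-≗ λ x → ∑words-rotate r (f ∘ (rotate x ∷_)))
  (sum-rotate λ x → ∑words r (f ∘ (x ∷_)))

symmetric-∑words : ∀ {N} r (f : List (Fin N) → ℕ) → Symmetric f →
  Symmetric λ S → ∑words r λ w → f (S ++ toList w)
symmetric-∑words r f sym-f p = ∑words-cong r λ w → sym-f (++⁺ʳ (toList w) p)

-- Rotation permutes the alphabet of the words and permutes the j-subsets of residues; only the
-- order in which a subset is listed may change, and `f` ignores it.
∑pairs-rotate : ∀ {n} j r (f : List (Fin (suc n)) → ℕ) → Symmetric f →
  ∑pairs j r (f ∘ List.map rotate) ≡ ∑pairs j r f
∑pairs-rotate {n} j r f sym-f = begin
  ∑combos j (List.tabulate id) (λ S → ∑words r λ w → f (List.map rotate (S ++ toList w)))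
    ≡⟨ ∑combos-cong j (List.tabulate id) (λ S _ → trans
         (∑words-cong r λ w → cong f (trans (List.map-++ rotate S (toList w))
           (cong (List.map rotate S ++_) (sym (Vec.toList-map rotate w)))))
         (∑words-rotate r λ w → f (List.map rotate S ++ toList w))) ⟩
  ∑combos j (List.tabulate id) (F ∘ List.map rotate)
    ≡⟨ ∑combos-map rotate j (List.tabulate id) F ⟨
  ∑combos j (List.map rotate (List.tabulate id)) F
    ≡⟨ cong (λ L → ∑combos j L F) (List.map-tabulate id rotate) ⟩
  ∑combos j (List.tabulate rotate) F
    ≡⟨ ∑combos-↭ j F (symmetric-∑words r f sym-f) (tabulate-last-first n id) ⟨
  ∑combos j (List.tabulate id) F ∎
  where
  F : List (Fin (suc n)) → ℕ
  F S = ∑words r λ w → f (S ++ toList w)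

-- Rotating the pairs moves the minimum from `v` to `rotate v` without changing the set of pairs.
∑pairs-argmin : ∀ {n} j r → j + r ≡ n → (v : Fin (suc n)) →
  ∑pairs j r (λ L → 𝟙 (isArgmin? (height L) v)) ≡ ∑pairs j r (λ L → 𝟙 (parking? L))
-- `rotate (suc i)` is `inject₁ i`, so `step (suc i)` links consecutive indices.
∑pairs-argmin {n} j r eq = <-weakInduction P refl λ i Pi → trans (step (suc i)) Pi
  where
  Q : Fin (suc n) → ℕ
  Q v = ∑pairs j r (λ L → 𝟙 (isArgmin? (height L) v))

  P : Fin (suc n) → Set
  P v = Q v ≡ Q zero

  step : ∀ v → Q v ≡ Q (rotate v)
  step v = trans
    (∑pairs-cong j r λ L ∣L∣ → sym (argmin-rotate L (trans ∣L∣ eq) v))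
    (∑pairs-rotate j r _ (symmetric-argmin (rotate v)))

-- All n + 1 positions of the minimum are equally frequent, and each pair has exactly one, so
-- together they count every pair once.
∑pairs-parking : ∀ {n} j r → j + r ≡ n →
  suc n * ∑pairs {n} j r (λ L → 𝟙 (parking? L)) ≡ (suc n C j) * suc n ^ r
∑pairs-parking {n} j r eq = begin
  suc n * ∑pairs {n} j r (λ L → 𝟙 (parking? L))
    ≡⟨ sum-const (suc n) _ ⟨
  sum {suc n} (λ _ → ∑pairs {n} j r (λ L → 𝟙 (parking? L)))
    ≡⟨ sum-cong-≗ (∑pairs-argmin j r eq) ⟨
  sum (λ v → ∑pairs j r (λ L → 𝟙 (isArgmin? (height L) v)))
    ≡⟨ ∑combos-∑ j all (λ v S → ∑words r λ w → 𝟙 (isArgmin? (height (S ++ toList w)) v)) ⟨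
  ∑combos j all (λ S → sum λ v → ∑words r λ w → 𝟙 (isArgmin? (height (S ++ toList w)) v))
    ≡⟨ ∑combos-cong j all (λ S _ → trans
         (sym (∑words-∑ r λ v w → 𝟙 (isArgmin? (height (S ++ toList w)) v)))
         (trans (∑words-cong r λ w → sum-argmin (height (S ++ toList w)) (height-injective (S ++ toList w)))
           (∑words-const r))) ⟩
  ∑combos j all (λ _ → suc n ^ r)
    ≡⟨ ∑combos-const j all (suc n ^ r) ⟩
  (length all C j) * suc n ^ r
    ≡⟨ cong (λ l → (l C j) * suc n ^ r) (List.length-tabulate {n = suc n} id) ⟩
  (suc n C j) * suc n ^ r ∎
  where
  all : List (Fin (suc n))
  all = List.tabulate id

-- Parking needs n entries below n, but the head is not below n and `L` has fewer than n entries.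
parking-last : ∀ {n} (L : List (Fin (suc n))) → length L < n → ¬ Parking (fromℕ n ∷ L)
parking-last {n} L ∣L∣<n park = <⇒≱ ∣L∣<n (≤-trans (parking⇒below (fromℕ n ∷ L) park n ≤-refl)
  (≤-trans (≤-reflexive (cong (_+ below n L)
      (𝟙-false (toℕ (fromℕ n) <? n) (≤⇒≯ (≤-reflexive (sym (Fin.toℕ-fromℕ n)))))))
    (below≤length n L)))
  where
  below≤length : ∀ {N} m (L : List (Fin N)) → below m L ≤ length L
  below≤length m []      = z≤n
  below≤length m (x ∷ L) = +-mono-≤ (𝟙≤1 (toℕ x <? m)) (below≤length m L)

-- Marked positions range over n residues, rotation needs all n + 1. The additional subsets contain
-- `fromℕ n` and contribute nothing.
∑pairs-parking-inject₁ : ∀ {n} j r → j + r ≡ n →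
  ∑combos j (List.tabulate inject₁) (λ S → ∑words r λ w → 𝟙 (parking? {n} (S ++ toList w))) ≡
  ∑pairs j r (λ L → 𝟙 (parking? L))
∑pairs-parking-inject₁ {n} j r eq = sym (trans
  (∑combos-↭ j F (symmetric-∑words r _ (symmetric-argmin zero)) (tabulate-last-first n id))
  (drop-last j eq))
  where
  F : List (Fin (suc n)) → ℕ
  F S = ∑words r λ w → 𝟙 (parking? (S ++ toList w))

  drop-last : ∀ j → j + r ≡ n →
    ∑combos j (fromℕ n ∷ List.tabulate inject₁) F ≡ ∑combos j (List.tabulate inject₁) F
  drop-last zero    eq = refl
  drop-last (suc j) eq = begin
    ∑combos (suc j) (List.tabulate inject₁) F + ∑combos j (List.tabulate inject₁) (F ∘ (fromℕ n ∷_))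
      ≡⟨ cong (_+_ (∑combos (suc j) (List.tabulate inject₁) F)) (trans
           (∑combos-cong j (List.tabulate inject₁) λ S ∣S∣ → trans
             (∑words-cong r λ w → 𝟙-false (parking? (fromℕ n ∷ S ++ toList w)) (parking-last (S ++ toList w)
               (≤-reflexive (trans (cong suc (trans (List.length-++ S) (cong₂ _+_ ∣S∣ (Vec.length-toList w))))
                 eq))))
             (∑words-zero r))
           (∑combos-zero j (List.tabulate {n = n} inject₁))) ⟩
    ∑combos (suc j) (List.tabulate inject₁) F + 0  ≡⟨ +-identityʳ _ ⟩
    ∑combos (suc j) (List.tabulate inject₁) F      ∎

-- Parking functions as words over Fin (suc n)

atMost : ℕ → List ℕ → ℕ
atMost t L = sumList (List.map (λ x → 𝟙 (x ≤? t)) L)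

atMost-none : ∀ {t L} → List-All.All (t <_) L → atMost t L ≡ 0
atMost-none         List-All.[]           = refl
atMost-none {t} {x ∷ L} (t<x List-All.∷ t<L) = cong₂ _+_ (𝟙-false (x ≤? t) (<⇒≱ t<x)) (atMost-none t<L)

-- Entries before index `i` of a sorted list do not exceed the one at `i`, so indices 0 to `i` all
-- count.
lookup≤⇒<atMost : ∀ {t L} → AllPairs _≤_ L → ∀ i → List.lookup L i ≤ t → toℕ i < atMost t L
lookup≤⇒<atMost {t} {x ∷ L} (_ ∷ _) zero x≤t =
  subst (λ b → 0 < b + atMost t L) (sym (𝟙-true (x ≤? t) x≤t)) z<s
lookup≤⇒<atMost {t} {x ∷ L} (x≤L ∷ L↗) (suc i) Li≤t =
  subst (λ b → suc (toℕ i) < b + atMost t L)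
    (sym (𝟙-true (x ≤? t) (≤-trans (List-All.lookup x≤L (∈-lookup i)) Li≤t)))
    (s<s (lookup≤⇒<atMost L↗ i Li≤t))

<atMost⇒lookup≤ : ∀ {t L} → AllPairs _≤_ L → ∀ i → toℕ i < atMost t L → List.lookup L i ≤ t
<atMost⇒lookup≤ {t} {x ∷ L} (x≤L ∷ L↗) i i< with x ≤? t | i
... | yes x≤t | zero  = x≤t
... | yes x≤t | suc i = <atMost⇒lookup≤ L↗ i
  (s<s⁻¹ (subst (λ b → suc (toℕ i) < b + atMost t L) (𝟙-true (x ≤? t) x≤t) i<))
-- Once the head exceeds `t`, so does the whole sorted list, and the count is zero.
... | no  x≰t | i     = contradiction
  (subst (toℕ i <_) (atMost-none (≰⇒> x≰t List-All.∷ List-All.map (<-≤-trans (≰⇒> x≰t)) x≤L)) i<) λ ()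

entries : ∀ {N m} → Vec (Fin N) m → Vec ℕ m
entries = Vec.map (suc ∘ toℕ)

-- Sorting preserves counts, and x + 1 ≤ t is by definition x < t.
atMost-sort-entries : ∀ {N m} t (w : Vec (Fin N) m) →
  atMost t (sort (toList (entries w))) ≡ below t (toList w)
atMost-sort-entries t w = trans (sum-↭ (map⁺ _ (sort-↭ (toList (entries w)))))
  (cong sumList (trans (cong (List.map _) (Vec.toList-map _ w)) (sym (List.map-∘ (toList w)))))

length-sort : ∀ {n} (π : Vec ℕ n) → length (sort (toList π)) ≡ n
length-sort π = trans (↭-length (sort-↭ (toList π))) (Vec.length-toList π)

sort-↗↗ : ∀ L → AllPairs _≤_ (sort L)
sort-↗↗ L = Sorted⇒AllPairs ≤-totalOrder (sort-↗ L)

isParkingFunction⇒parking : ∀ {n} (w : Vec (Fin (suc n)) n) → IsParkingFunction (entries w) → Parking (toList w)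
isParkingFunction⇒parking {n} w (_ , sorted≤) = below⇒parking (toList w) enough
  where
  L = sort (toList (entries w))
  enough : ∀ m → m ≤ n → m ≤ below m (toList w)
  enough zero    _     = z≤n
  -- The sorted entry at zero-based index `m` is at most m + 1, so at least m + 1 entries are.
  enough (suc m) 1+m≤n = subst₂ _<_ toℕ-i
    (trans (cong (λ m → atMost (suc m) L) toℕ-i) (atMost-sort-entries (suc m) w))
    (lookup≤⇒<atMost (sort-↗↗ _) i (sorted≤ i))
    where
    m<∣L∣ = ≤-trans 1+m≤n (≤-reflexive (sym (length-sort (entries w))))
    i = fromℕ< m<∣L∣
    toℕ-i = Fin.toℕ-fromℕ< m<∣L∣

parking⇒isParkingFunction : ∀ {n} (w : Vec (Fin (suc n)) n) → Parking (toList w) → IsParkingFunction (entries w)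
parking⇒isParkingFunction {n} w park = All.map⁺ (All.universal (λ _ → z<s) w) , λ i →
  <atMost⇒lookup≤ (sort-↗↗ _) i (≤-trans
    (parking⇒below (toList w) park (suc (toℕ i)) (≤-trans (Fin.toℕ<n i) (≤-reflexive (length-sort (entries w)))))
    (≤-reflexive (sym (atMost-sort-entries (suc (toℕ i)) w))))

-- Every sorted entry is bounded by its one-based index, hence by `n`; this makes the alphabet
-- finite.
isParkingFunction⇒≤n : ∀ {n} (π : Vec ℕ n) → IsParkingFunction π → All (_≤ n) π
isParkingFunction⇒≤n {n} π (_ , sorted≤) = All.toList⁻ (All-resp-↭ (sort-↭ (toList π))
  (subst (List-All.All (_≤ n)) (List.tabulate-lookup _) (List-All.tabulate⁺ λ i →
    ≤-trans (sorted≤ i) (≤-trans (Fin.toℕ<n i) (≤-reflexive (length-sort π))))))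

-- On values from 1 to n + 1 the reduction changes nothing; elsewhere the result is a default.
toEntry : ∀ {n} → ℕ → Fin (suc n)
toEntry {n} x = pred x mod suc n

toℕ-mod : ∀ {n} x → toℕ (x mod suc n) ≡ x % suc n
toℕ-mod {n} x = Fin.toℕ-fromℕ< (m%n<n x (suc n))

toEntry-entry : ∀ {n m} (w : Vec (Fin (suc n)) m) → Vec.map toEntry (entries w) ≡ w
toEntry-entry []      = refl
toEntry-entry (x ∷ w) = cong₂ _∷_
  (Fin.toℕ-injective (trans (toℕ-mod (toℕ x)) (m<n⇒m%n≡m (Fin.toℕ<n x)))) (toEntry-entry w)

entries-toEntry : ∀ {n m} (π : Vec ℕ m) → All (1 ≤_) π → All (_≤ n) π →
  entries (Vec.map (toEntry {n}) π) ≡ π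
entries-toEntry []          _          _          = refl
entries-toEntry (suc x ∷ π) (_ ∷ 1≤π) (x<n ∷ π≤n) = cong₂ _∷_
  (cong suc (trans (toℕ-mod x) (m<n⇒m%n≡m (m<n⇒m<1+n x<n)))) (entries-toEntry π 1≤π π≤n)

refinement-entries : ∀ {n m} {P : Vec ℕ m → Set} → (∀ π → P π → All (1 ≤_) π × All (_≤ n) π) →
  [ π ∈ Vec ℕ m ∣ P π ] ↔ [ w ∈ Vec (Fin (suc n)) m ∣ P (entries w) ]
refinement-entries {n} {m} {P} bounded = mk↔ₛ′ to from to∘from from∘to
  where
  restore : ∀ π → P π → entries (Vec.map (toEntry {n}) π) ≡ π
  restore π p = entries-toEntry π (proj₁ (bounded π p)) (proj₂ (bounded π p))

  to : [ π ∈ Vec ℕ m ∣ P π ] → [ w ∈ Vec (Fin (suc n)) m ∣ P (entries w) ]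
  to (π , [ p ]) = Vec.map toEntry π , [ subst P (sym (restore π p)) p ]

  from : [ w ∈ Vec (Fin (suc n)) m ∣ P (entries w) ] → [ π ∈ Vec ℕ m ∣ P π ]
  from (w , [ p ]) = entries w , [ p ]

  same-value : ∀ {A : Set} {Q : A → Set} {v v′ : Refinement A Q} → value v ≡ value v′ → v ≡ v′
  same-value refl = refl

  to∘from : ∀ w → to (from w) ≡ w
  to∘from (w , _) = same-value (toEntry-entry w)

  from∘to : ∀ π → from (to π) ≡ π
  -- As `p` is irrelevant, the equation derived from it is recovered by deciding equality of
  -- vectors.
  from∘to (π , [ p ]) = same-value (recompute (Vec.≡-dec _≟_ _ _) (restore π p))

-- Counting words by bijections

Σ-Fin↔Fin-sum : ∀ {N} (c : Fin N → ℕ) → Σ (Fin N) (Fin ∘ c) ↔ Fin (sum c)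
Σ-Fin↔Fin-sum {zero}  c = mk↔ₛ′ (λ ()) (λ ()) (λ ()) (λ ())
Σ-Fin↔Fin-sum {suc N} c = ↔-trans
  (mk↔ₛ′ (λ { (zero , i) → inj₁ i ; (suc x , i) → inj₂ (x , i) })
         (λ { (inj₁ i) → zero , i ; (inj₂ (x , i)) → suc x , i })
         (λ { (inj₁ i) → refl ; (inj₂ (x , i)) → refl })
         (λ { (zero , i) → refl ; (suc x , i) → refl }))
  (↔-trans (↔-refl ⊎-↔ Σ-Fin↔Fin-sum (c ∘ suc)) (↔-sym (Fin.+↔⊎ {c zero})))

-- Irrelevance of the membership proof makes the type at the empty word a singleton or empty; longer
-- words split off their first letter.
words↔ : ∀ {N} m {P : Vec (Fin N) m → Set} (P? : Decidable P) →
  [ w ∈ Vec (Fin N) m ∣ P w ] ↔ Fin (∑words m λ w → 𝟙 (P? w))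
words↔ zero P? with P? []
... | yes p = mk↔ₛ′ (λ _ → zero) (λ _ → [] , [ p ]) (λ { zero → refl }) (λ { ([] , _) → refl })
... | no ¬p = mk↔ₛ′ (λ { ([] , [ p ]) → ⊥-elim-irr (¬p p) }) (λ ()) (λ ()) (λ { ([] , [ p ]) → ⊥-elim-irr (¬p p) })
words↔ {N} (suc m) {P} P? = ↔-trans
  (mk↔ₛ′ {B = Σ (Fin N) λ x → [ w ∈ Vec (Fin N) m ∣ P (x ∷ w) ]}
    (λ { (x ∷ w , p) → x , (w , p) }) (λ { (x , (w , p)) → x ∷ w , p })
    (λ { (x , (w , p)) → refl }) (λ { (x ∷ w , p) → refl }))
  (↔-trans (Σ-↔ ↔-refl λ {x} → words↔ m (P? ∘ (x ∷_))) (Σ-Fin↔Fin-sum λ x → ∑words m λ w → 𝟙 (P? (x ∷ w))))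

count-tabulate : ∀ {A : Set} {P : A → Set} (P? : Decidable P) {m} (f : Fin m → A) →
  Vec.count P? (Vec.tabulate f) ≡ sum (λ i → 𝟙 (P? (f i)))
count-tabulate P? {zero}  f = refl
count-tabulate P? {suc m} f with P? (f zero)
... | yes _ = cong suc (count-tabulate P? (f ∘ suc))
... | no  _ = count-tabulate P? (f ∘ suc)

-- Positions and letters are both shifted by one, and the shifts cancel.
#fixedPoints-entries : ∀ {n} (w : Vec (Fin (suc n)) n) → #fixedPoints (entries w) ≡ hits inject₁ w
#fixedPoints-entries w = trans (count-tabulate (fixedPoint? (entries w)) id) (sum-cong-≗ λ i →
  𝟙-cong (fixedPoint? (entries w) i) (lookup w i Fin.≟ inject₁ i)
    (λ eq → Fin.toℕ-injective (trans (suc-injective (trans (sym (Vec.lookup-map i _ w)) eq))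
      (sym (Fin.toℕ-inject₁ i))))
    (λ eq → trans (Vec.lookup-map i _ w) (cong suc (trans (cong toℕ eq) (Fin.toℕ-inject₁ i)))))

numberWithHits : ℕ → ℕ → ℕ
numberWithHits n k = ∑words {suc n} n λ w → 𝟙 (hits inject₁ w ≟ k) * 𝟙 (parking? (toList w))

parkingFunctions↔ : ∀ n k → ParkingFunctionWithFixedPoints n k ↔ Fin (numberWithHits n k)
parkingFunctions↔ n k = ↔-trans
  (refinement-entries λ π p → proj₁ (proj₁ p) , isParkingFunction⇒≤n π (proj₁ p))
  (subst (λ c → [ w ∈ Vec (Fin (suc n)) n ∣ P w ] ↔ Fin c)
    (∑words-cong n λ w → trans
      (𝟙-cong (P? w) ((hits inject₁ w ≟ k) ×-dec parking? (toList w))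
        (λ { (pf , fp) → trans (sym (#fixedPoints-entries w)) fp , isParkingFunction⇒parking w pf })
        (λ { (hits≡k , park) → parking⇒isParkingFunction w park , trans (#fixedPoints-entries w) hits≡k }))
      (𝟙-× (hits inject₁ w ≟ k) (parking? (toList w))))
    (words↔ n P?))
  where
  P : Vec (Fin (suc n)) n → Set
  P w = IsParkingFunction (entries w) × #fixedPoints (entries w) ≡ k

  P? : Decidable P
  P? w = (All.all? (1 ≤?_) (entries w) ×-dec Fin.all? λ i → List.lookup (sort (toList (entries w))) i ≤? suc (toℕ i))
    ×-dec (#fixedPoints (entries w) ≟ k)

-- Moments and their inversion

sum-𝟙-toℕ : ∀ {n h} → h ≤ n → (f : ℕ → ℕ) → sum {suc n} (λ k → 𝟙 (h ≟ toℕ k) * f (toℕ k)) ≡ f h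
sum-𝟙-toℕ {n} {h} h≤n f = trans
  (sum-cong-≗ λ k → cong (_* f (toℕ k)) (𝟙-cong (h ≟ toℕ k) (k Fin.≟ fromℕ< (s≤s h≤n))
    (λ h≡k → Fin.toℕ-injective (trans (sym h≡k) (sym toℕ-h)))
    (λ { refl → sym toℕ-h })))
  (trans (sum-𝟙 (fromℕ< (s≤s h≤n)) (f ∘ toℕ)) (cong f toℕ-h))
  where
  toℕ-h = Fin.toℕ-fromℕ< (s≤s h≤n)

-- After exchanging the sums, only `k = h w` survives for each word, and its weight `h w C j` is
-- what `expand` turns into marked positions.
numberWithHits-moment : ∀ {n} j → j ≤ n →
  sum {suc n} (λ k → numberWithHits n (toℕ k) * (toℕ k C j)) ≡ ∑pairs j (n ∸ j) (λ L → 𝟙 (parking? {n} L))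
numberWithHits-moment {n} j j≤n = begin
  sum {suc n} (λ k → numberWithHits n (toℕ k) * (toℕ k C j))
    ≡⟨ sum-cong-≗ {suc n} (λ k → trans (*-comm (numberWithHits n (toℕ k)) (toℕ k C j))
         (sym (∑words-* n (toℕ k C j) (λ w → 𝟙 (h w ≟ toℕ k) * 𝟙 (parking? (toList w)))))) ⟩
  sum {suc n} (λ k → ∑words n λ w → (toℕ k C j) * (𝟙 (h w ≟ toℕ k) * 𝟙 (parking? (toList w))))
    ≡⟨ ∑words-∑ {M = suc n} n (λ k w → (toℕ k C j) * (𝟙 (h w ≟ toℕ k) * 𝟙 (parking? (toList w)))) ⟨
  ∑words n (λ w → sum {suc n} λ k → (toℕ k C j) * (𝟙 (h w ≟ toℕ k) * 𝟙 (parking? (toList w))))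
    ≡⟨ ∑words-cong n (λ w → trans
         (sum-cong-≗ {suc n} λ k → swap-factors (toℕ k C j) (𝟙 (h w ≟ toℕ k)) (𝟙 (parking? (toList w))))
         (sum-𝟙-toℕ (hits≤ inject₁ w) λ k → (k C j) * 𝟙 (parking? (toList w)))) ⟩
  ∑words n (λ w → (h w C j) * 𝟙 (parking? (toList w)))
    ≡⟨ expand inject₁ j (n ∸ j) _ (symmetric-argmin zero) (m+[n∸m]≡n j≤n) ⟩
  ∑combos j (List.tabulate inject₁) (λ S → ∑words (n ∸ j) λ w → 𝟙 (parking? {n} (S ++ toList w)))
    ≡⟨ ∑pairs-parking-inject₁ j (n ∸ j) (m+[n∸m]≡n j≤n) ⟩
  ∑pairs j (n ∸ j) (λ L → 𝟙 (parking? L)) ∎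
  where
  h : Vec (Fin (suc n)) n → ℕ
  h = hits inject₁

  swap-factors : ∀ a b c → a * (b * c) ≡ b * (a * c)
  swap-factors = solve-∀

-- One factor `suc n` is consumed by the cycle lemma; the other raises the exponent to `suc n ∸ j`,
-- as in the binomial sums for the closed form.
scaled-moment : ∀ {n} j → j ≤ n →
  suc n ^ 2 * sum {suc n} (λ k → numberWithHits n (toℕ k) * (toℕ k C j)) ≡ (suc n C j) * suc n ^ (suc n ∸ j)
scaled-moment {n} j j≤n = begin
  suc n ^ 2 * sum {suc n} (λ k → numberWithHits n (toℕ k) * (toℕ k C j))
    ≡⟨ cong (suc n ^ 2 *_) (numberWithHits-moment j j≤n) ⟩
  suc n ^ 2 * pairs                        ≡⟨ lemma₁ (suc n) pairs ⟩
  suc n * (suc n * pairs)                  ≡⟨ cong (suc n *_) (∑pairs-parking j (n ∸ j) (m+[n∸m]≡n j≤n)) ⟩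
  suc n * ((suc n C j) * suc n ^ (n ∸ j))  ≡⟨ lemma₂ (suc n) (suc n C j) (suc n ^ (n ∸ j)) ⟩
  (suc n C j) * suc n ^ suc (n ∸ j)        ≡⟨ cong (λ e → (suc n C j) * suc n ^ e) (+-∸-assoc 1 j≤n) ⟨
  (suc n C j) * suc n ^ (suc n ∸ j)        ∎
  where
  pairs = ∑pairs j (n ∸ j) (λ L → 𝟙 (parking? {n} L))
  lemma₁ : ∀ a b → a * (a * 1) * b ≡ a * (a * b)
  lemma₁ = solve-∀
  lemma₂ : ∀ a b c → a * (b * c) ≡ b * (a * c)
  lemma₂ = solve-∀

-- Integer sums, binomial moments and the binomial theorem

∑ℤ : ℕ → (ℕ → ℤ) → ℤ
∑ℤ n f = ℤSum.sum {n} (f ∘ toℕ)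

∑ℤ-cong : ∀ n {f g : ℕ → ℤ} → (∀ k → k < n → f k ≡ g k) → ∑ℤ n f ≡ ∑ℤ n g
∑ℤ-cong n f≗g = ℤSum.sum-cong-≗ {n} λ k → f≗g (toℕ k) (Fin.toℕ<n k)

∑ℤ-last : ∀ n f → ∑ℤ (suc n) f ≡ ∑ℤ n f ℤ.+ f n
∑ℤ-last n f = trans (ℤSum.sum-init-last {n} (f ∘ toℕ)) (cong₂ ℤ._+_
  (ℤSum.sum-cong-≗ {n} λ k → cong f (Fin.toℕ-inject₁ k)) (cong f (Fin.toℕ-fromℕ n)))

∑ℤ-+ : ∀ n f g → ∑ℤ n (λ k → f k ℤ.+ g k) ≡ ∑ℤ n f ℤ.+ ∑ℤ n g
∑ℤ-+ n f g = ℤSum.∑-distrib-+ {n} (f ∘ toℕ) (g ∘ toℕ)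

∑ℤ-* : ∀ n c f → ∑ℤ n (λ k → c ℤ.* f k) ≡ c ℤ.* ∑ℤ n f
∑ℤ-* n c f = sym (ℤSum.*-distribˡ-sum {n} c (f ∘ toℕ))

∑ℤ-pos : ∀ n (f : ℕ → ℕ) → ∑ℤ n (λ k → + f k) ≡ + sum {n} (f ∘ toℕ)
∑ℤ-pos zero    f = refl
∑ℤ-pos (suc n) f = cong (ℤ._+_ (+ f 0)) (∑ℤ-pos n (f ∘ suc))

∑ℤ-zero : ∀ n → ∑ℤ n (λ _ → 0ℤ) ≡ 0ℤ
∑ℤ-zero n = ∑ℤ-* n 0ℤ (λ _ → 0ℤ)

-- The matrix k C j is unitriangular, so the last X is read off from the last moment.
binomial-moments-zero : ∀ n (X : ℕ → ℤ) →
  (∀ j → j < n → ∑ℤ n (λ k → X k ℤ.* + (k C j)) ≡ 0ℤ) → ∀ k → k < n → X k ≡ 0ℤ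
binomial-moments-zero (suc n) X moments = vanish
  where
  init = ∑ℤ n (λ k → X k ℤ.* + (k C n))

  Xn≡0 : X n ≡ 0ℤ
  Xn≡0 = begin
    X n                            ≡⟨ ℤ.*-identityʳ (X n) ⟨
    X n ℤ.* 1ℤ                     ≡⟨ cong (λ c → X n ℤ.* + c) (nCn≡1 n) ⟨
    X n ℤ.* + (n C n)              ≡⟨ ℤ.+-identityˡ _ ⟨
    0ℤ ℤ.+ X n ℤ.* + (n C n)       ≡⟨ cong (ℤ._+ X n ℤ.* + (n C n)) (trans
                                        (∑ℤ-cong n λ k k<n → trans (cong (λ c → X k ℤ.* + c) (k>n⇒nCk≡0 k<n)) (ℤ.*-zeroʳ (X k)))
                                        (∑ℤ-zero n)) ⟨
    init ℤ.+ X n ℤ.* + (n C n)     ≡⟨ ∑ℤ-last n (λ k → X k ℤ.* + (k C n)) ⟨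
    ∑ℤ (suc n) (λ k → X k ℤ.* + (k C n))  ≡⟨ moments n ≤-refl ⟩
    0ℤ                             ∎

  smaller : ∀ j → j < n → ∑ℤ n (λ k → X k ℤ.* + (k C j)) ≡ 0ℤ
  smaller j j<n = begin
    ∑ℤ n (λ k → X k ℤ.* + (k C j))                            ≡⟨ ℤ.+-identityʳ _ ⟨
    ∑ℤ n (λ k → X k ℤ.* + (k C j)) ℤ.+ 0ℤ ℤ.* + (n C j)      ≡⟨ cong (λ x → ∑ℤ n (λ k → X k ℤ.* + (k C j)) ℤ.+ x ℤ.* + (n C j))
                                                                      Xn≡0 ⟨
    ∑ℤ n (λ k → X k ℤ.* + (k C j)) ℤ.+ X n ℤ.* + (n C j)     ≡⟨ ∑ℤ-last n (λ k → X k ℤ.* + (k C j)) ⟨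
    ∑ℤ (suc n) (λ k → X k ℤ.* + (k C j))                     ≡⟨ moments j (m<n⇒m<1+n j<n) ⟩
    0ℤ ∎

  vanish : ∀ k → k < suc n → X k ≡ 0ℤ
  vanish k k<1+n with m≤n⇒m<n∨m≡n (s≤s⁻¹ k<1+n)
  ... | inj₁ k<n  = binomial-moments-zero n X smaller k k<n
  ... | inj₂ refl = Xn≡0

-- (y + E)ᴺ f 0, where E is the shift operator.
shiftPower : ℕ → ℤ → (ℕ → ℤ) → ℤ
shiftPower zero    y f = f 0
shiftPower (suc N) y f = y ℤ.* shiftPower N y f ℤ.+ shiftPower N y (f ∘ suc)

shiftPower-cong : ∀ N y {f g} → (∀ k → f k ≡ g k) → shiftPower N y f ≡ shiftPower N y g
shiftPower-cong zero    y f≗g = f≗g 0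
shiftPower-cong (suc N) y f≗g = cong₂ (λ a b → y ℤ.* a ℤ.+ b) (shiftPower-cong N y f≗g) (shiftPower-cong N y (f≗g ∘ suc))

shiftPower-+ : ∀ N y f g → shiftPower N y (λ k → f k ℤ.+ g k) ≡ shiftPower N y f ℤ.+ shiftPower N y g
shiftPower-+ zero    y f g = refl
shiftPower-+ (suc N) y f g = trans
  (cong₂ (λ a b → y ℤ.* a ℤ.+ b) (shiftPower-+ N y f g) (shiftPower-+ N y (f ∘ suc) (g ∘ suc)))
  (lemma y (shiftPower N y f) (shiftPower N y g) _ _)
  where
  lemma : ∀ y a b c d → y ℤ.* (a ℤ.+ b) ℤ.+ (c ℤ.+ d) ≡ y ℤ.* a ℤ.+ c ℤ.+ (y ℤ.* b ℤ.+ d)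
  lemma = solve-∀ℤ

-- Pascal's rule splits (y + E)ᴺ⁺¹ f into y (y + E)ᴺ f and (y + E)ᴺ applied to the shifted sequence.
∑-binomial : ∀ N y f →
  ∑ℤ (suc N) (λ k → + (N C k) ℤ.* y ℤ.^ (N ∸ k) ℤ.* f k) ≡ shiftPower N y f
∑-binomial zero y f = trans (ℤ.+-identityʳ _) (ℤ.*-identityˡ (f 0))
∑-binomial (suc N) y f = begin
  1ℤ ℤ.* y ℤ.^ suc N ℤ.* f 0 ℤ.+ ∑ℤ (suc N) (λ k → + (suc N C suc k) ℤ.* y ℤ.^ (N ∸ k) ℤ.* f (suc k))
    ≡⟨ cong (ℤ._+_ (g 0)) (trans
         (∑ℤ-cong (suc N) λ k _ → trans
           (cong (λ c → c ℤ.* y ℤ.^ (N ∸ k) ℤ.* f (suc k))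
             (trans (cong +_ (sym (nCk+nC[k+1]≡[n+1]C[k+1] N k))) (ℤ.pos-+ (N C k) _)))
           (distr (+ (N C k)) (+ (N C suc k)) (y ℤ.^ (N ∸ k)) (f (suc k))))
         (∑ℤ-+ (suc N) (λ k → + (N C k) ℤ.* y ℤ.^ (N ∸ k) ℤ.* f (suc k)) (g ∘ suc))) ⟩
  g 0 ℤ.+ (∑ℤ (suc N) (λ k → + (N C k) ℤ.* y ℤ.^ (N ∸ k) ℤ.* f (suc k)) ℤ.+ ∑ℤ (suc N) (g ∘ suc))
    ≡⟨ cong (λ s → g 0 ℤ.+ (s ℤ.+ ∑ℤ (suc N) (g ∘ suc))) (∑-binomial N y (f ∘ suc)) ⟩
  g 0 ℤ.+ (shiftPower N y (f ∘ suc) ℤ.+ ∑ℤ (suc N) (g ∘ suc))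
    ≡⟨ rearrange (g 0) (shiftPower N y (f ∘ suc)) _ ⟩
  ∑ℤ (2+ N) g ℤ.+ shiftPower N y (f ∘ suc)
    ≡⟨ cong (ℤ._+ shiftPower N y (f ∘ suc)) ∑g ⟩
  y ℤ.* shiftPower N y f ℤ.+ shiftPower N y (f ∘ suc) ∎
  where
  g : ℕ → ℤ
  g k = + (N C k) ℤ.* y ℤ.^ (suc N ∸ k) ℤ.* f k

  distr : ∀ a b c d → (a ℤ.+ b) ℤ.* c ℤ.* d ≡ a ℤ.* c ℤ.* d ℤ.+ b ℤ.* c ℤ.* d
  distr = solve-∀ℤ

  rearrange : ∀ a b c → a ℤ.+ (b ℤ.+ c) ≡ a ℤ.+ c ℤ.+ b
  rearrange = solve-∀ℤ

  pull : ∀ c y p f → c ℤ.* (y ℤ.* p) ℤ.* f ≡ y ℤ.* (c ℤ.* p ℤ.* f)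
  pull = solve-∀ℤ

  ∑g : ∑ℤ (2+ N) g ≡ y ℤ.* shiftPower N y f
  ∑g = begin
    -- The term at N + 1 has coefficient `N C suc N`, which is zero; for k ≤ N one factor `y` can be
    -- split off.
    ∑ℤ (2+ N) g              ≡⟨ ∑ℤ-last (suc N) g ⟩
    ∑ℤ (suc N) g ℤ.+ g (suc N)
      ≡⟨ cong (λ c → ∑ℤ (suc N) g ℤ.+ + c ℤ.* y ℤ.^ (N ∸ N) ℤ.* f (suc N)) (k>n⇒nCk≡0 (n<1+n N)) ⟩
    ∑ℤ (suc N) g ℤ.+ 0ℤ      ≡⟨ ℤ.+-identityʳ _ ⟩
    ∑ℤ (suc N) g
      ≡⟨ ∑ℤ-cong (suc N) (λ k k≤N → trans
           (cong (λ e → + (N C k) ℤ.* y ℤ.^ e ℤ.* f k) (+-∸-assoc 1 (s≤s⁻¹ k≤N)))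
           (pull (+ (N C k)) y (y ℤ.^ (N ∸ k)) (f k))) ⟩
    ∑ℤ (suc N) (λ k → y ℤ.* (+ (N C k) ℤ.* y ℤ.^ (N ∸ k) ℤ.* f k))
      ≡⟨ ∑ℤ-* (suc N) y (λ k → + (N C k) ℤ.* y ℤ.^ (N ∸ k) ℤ.* f k) ⟩
    y ℤ.* ∑ℤ (suc N) (λ k → + (N C k) ℤ.* y ℤ.^ (N ∸ k) ℤ.* f k)
      ≡⟨ cong (y ℤ.*_) (∑-binomial N y f) ⟩
    y ℤ.* shiftPower N y f ∎

-- By Pascal's rule E sends k ↦ C(k, j + 1) to itself plus k ↦ C(k, j), whence the factor 1 + y.
-- With `∑-binomial` this evaluates the sum of C(N, k) C(k, j) yᴺ⁻ᵏ over k.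
shiftPower-C : ∀ N y j → shiftPower N y (λ k → + (k C j)) ≡ + (N C j) ℤ.* (1ℤ ℤ.+ y) ℤ.^ (N ∸ j)
shiftPower-C zero y j = sym (trans (cong (λ e → + (0 C j) ℤ.* (1ℤ ℤ.+ y) ℤ.^ e) (0∸n≡0 j)) (ℤ.*-identityʳ _))
shiftPower-C (suc N) y zero = trans
  (cong (λ s → y ℤ.* s ℤ.+ s) (shiftPower-C N y zero))
  (lemma y ((1ℤ ℤ.+ y) ℤ.^ N))
  where
  lemma : ∀ y p → y ℤ.* (1ℤ ℤ.* p) ℤ.+ 1ℤ ℤ.* p ≡ 1ℤ ℤ.* ((1ℤ ℤ.+ y) ℤ.* p)
  lemma = solve-∀ℤ
shiftPower-C (suc N) y (suc j) = begin
  y ℤ.* shiftPower N y (λ k → + (k C suc j)) ℤ.+ shiftPower N y (λ k → + (suc k C suc j))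
    ≡⟨ cong₂ (λ a b → y ℤ.* a ℤ.+ b) (shiftPower-C N y (suc j)) (trans
         (shiftPower-cong N y λ k → trans (cong +_ (sym (nCk+nC[k+1]≡[n+1]C[k+1] k j))) (ℤ.pos-+ (k C j) _))
         (trans (shiftPower-+ N y (λ k → + (k C j)) (λ k → + (k C suc j)))
           (cong₂ ℤ._+_ (shiftPower-C N y j) (shiftPower-C N y (suc j))))) ⟩
  y ℤ.* (b ℤ.* p ℤ.^ (N ∸ suc j)) ℤ.+ (a ℤ.* p ℤ.^ (N ∸ j) ℤ.+ b ℤ.* p ℤ.^ (N ∸ suc j))
    ≡⟨ lemma₁ y a b (p ℤ.^ (N ∸ suc j)) (p ℤ.^ (N ∸ j)) ⟩
  b ℤ.* (p ℤ.* p ℤ.^ (N ∸ suc j)) ℤ.+ a ℤ.* p ℤ.^ (N ∸ j)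
    ≡⟨ cong (ℤ._+ a ℤ.* p ℤ.^ (N ∸ j)) raise ⟩
  b ℤ.* p ℤ.^ (N ∸ j) ℤ.+ a ℤ.* p ℤ.^ (N ∸ j)
    ≡⟨ lemma₂ a b (p ℤ.^ (N ∸ j)) ⟩
  (a ℤ.+ b) ℤ.* p ℤ.^ (N ∸ j)
    ≡⟨ cong (ℤ._* p ℤ.^ (N ∸ j)) (trans (sym (ℤ.pos-+ (N C j) _)) (cong +_ (nCk+nC[k+1]≡[n+1]C[k+1] N j))) ⟩
  + (suc N C suc j) ℤ.* p ℤ.^ (N ∸ j) ∎
  where
  p a b : ℤ
  p = 1ℤ ℤ.+ y
  a = + (N C j)
  b = + (N C suc j)

  lemma₁ : ∀ y a b q r → y ℤ.* (b ℤ.* q) ℤ.+ (a ℤ.* r ℤ.+ b ℤ.* q) ≡ b ℤ.* ((1ℤ ℤ.+ y) ℤ.* q) ℤ.+ a ℤ.* r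
  lemma₁ = solve-∀ℤ

  lemma₂ : ∀ a b r → b ℤ.* r ℤ.+ a ℤ.* r ≡ (a ℤ.+ b) ℤ.* r
  lemma₂ = solve-∀ℤ

  raise : b ℤ.* (p ℤ.* p ℤ.^ (N ∸ suc j)) ≡ b ℤ.* p ℤ.^ (N ∸ j)
  raise with suc j ≤? N
  ... | yes j<N = cong (λ e → b ℤ.* p ℤ.^ e) (sym (+-∸-assoc 1 j<N))
  -- The truncated exponents no longer differ by one, but the coefficient `b` is zero.
  ... | no  j≮N = subst (λ c → + c ℤ.* (p ℤ.* p ℤ.^ (N ∸ suc j)) ≡ + c ℤ.* p ℤ.^ (N ∸ j))
    (sym (k>n⇒nCk≡0 (≰⇒> j≮N))) refl

-- The closed form and its moments

i+-1*i≡0 : ∀ i → i ℤ.+ -1ℤ ℤ.* i ≡ 0ℤ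
i+-1*i≡0 = solve-∀ℤ

-- The claimed count multiplied by (n + 1)², which keeps it an integer.
closedForm : ℕ → ℕ → ℤ
closedForm n k = + (suc n C k) ℤ.* ((+ n) ℤ.^ (n ∸ k + 1) ℤ.- -1ℤ ℤ.^ (n ∸ k + 1))

pos-^ : ∀ m e → (+ m) ℤ.^ e ≡ + (m ^ e)
pos-^ m zero    = refl
pos-^ m (suc e) = trans (cong (+ m ℤ.*_) (pos-^ m e)) (sym (ℤ.pos-* m (m ^ e)))

-- The two powers give binomial sums at y = n and y = -1, where 1 + y is N and 0 respectively.
closedForm-moment : ∀ {n} j → j ≤ n →
  ∑ℤ (suc n) (λ k → closedForm n k ℤ.* + (k C j)) ≡ + ((suc n C j) * suc n ^ (suc n ∸ j))
closedForm-moment {n} j j≤n = begin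
  ∑ℤ (suc n) (λ k → closedForm n k ℤ.* + (k C j))
    ≡⟨ ∑ℤ-cong (suc n) (λ k k≤n → trans
         (cong (λ e → + (N C k) ℤ.* ((+ n) ℤ.^ e ℤ.- -1ℤ ℤ.^ e) ℤ.* + (k C j))
           (trans (+-comm (n ∸ k) 1) (sym (+-∸-assoc 1 (s≤s⁻¹ k≤n)))))
         (distr (+ (N C k)) ((+ n) ℤ.^ (N ∸ k)) (-1ℤ ℤ.^ (N ∸ k)) (+ (k C j)))) ⟩
  ∑ℤ N d                        ≡⟨ ℤ.+-identityʳ _ ⟨
  -- Adding the index k = N completes both binomial sums; its terms cancel, as both powers are 1
  -- there.
  ∑ℤ N d ℤ.+ 0ℤ                 ≡⟨ cong (λ x → ∑ℤ N d ℤ.+ x) dN≡0 ⟨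
  ∑ℤ N d ℤ.+ d N                ≡⟨ ∑ℤ-last N d ⟨
  ∑ℤ (suc N) d                  ≡⟨ ∑ℤ-+ (suc N) (t (+ n)) (λ k → -1ℤ ℤ.* t -1ℤ k) ⟩
  ∑ℤ (suc N) (t (+ n)) ℤ.+ ∑ℤ (suc N) (λ k → -1ℤ ℤ.* t -1ℤ k)
    ≡⟨ cong₂ ℤ._+_ (eval (+ n)) (trans (∑ℤ-* (suc N) -1ℤ (t -1ℤ)) (cong (-1ℤ ℤ.*_) (eval -1ℤ))) ⟩
  -- As j ≤ n, the exponent of `0ℤ` is positive and the second sum vanishes.
  + (N C j) ℤ.* (+ N) ℤ.^ (N ∸ j) ℤ.+ -1ℤ ℤ.* (+ (N C j) ℤ.* 0ℤ ℤ.^ (N ∸ j))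
    ≡⟨ cong (λ e → + (N C j) ℤ.* (+ N) ℤ.^ (N ∸ j) ℤ.+ -1ℤ ℤ.* (+ (N C j) ℤ.* 0ℤ ℤ.^ e)) (+-∸-assoc 1 j≤n) ⟩
  + (N C j) ℤ.* (+ N) ℤ.^ (N ∸ j) ℤ.+ -1ℤ ℤ.* (+ (N C j) ℤ.* (0ℤ ℤ.* 0ℤ ℤ.^ (n ∸ j)))
    ≡⟨ cancel (+ (N C j)) ((+ N) ℤ.^ (N ∸ j)) (0ℤ ℤ.^ (n ∸ j)) ⟩
  + (N C j) ℤ.* (+ N) ℤ.^ (N ∸ j)  ≡⟨ cong (+ (N C j) ℤ.*_) (pos-^ N (N ∸ j)) ⟩
  + (N C j) ℤ.* + (N ^ (N ∸ j))    ≡⟨ ℤ.pos-* (N C j) (N ^ (N ∸ j)) ⟨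
  + ((N C j) * N ^ (N ∸ j))        ∎
  where
  N = suc n

  t : ℤ → ℕ → ℤ
  t y k = + (N C k) ℤ.* y ℤ.^ (N ∸ k) ℤ.* + (k C j)

  d : ℕ → ℤ
  d k = t (+ n) k ℤ.+ -1ℤ ℤ.* t -1ℤ k

  eval : ∀ y → ∑ℤ (suc N) (t y) ≡ + (N C j) ℤ.* (1ℤ ℤ.+ y) ℤ.^ (N ∸ j)
  eval y = trans (∑-binomial N y (λ k → + (k C j))) (shiftPower-C N y j)

  distr : ∀ c p q r → c ℤ.* (p ℤ.- q) ℤ.* r ≡ c ℤ.* p ℤ.* r ℤ.+ -1ℤ ℤ.* (c ℤ.* q ℤ.* r)
  distr = solve-∀ℤ

  cancel : ∀ c p q → c ℤ.* p ℤ.+ -1ℤ ℤ.* (c ℤ.* (0ℤ ℤ.* q)) ≡ c ℤ.* p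
  cancel = solve-∀ℤ

  dN≡0 : d N ≡ 0ℤ
  dN≡0 = subst (λ e → + (N C N) ℤ.* (+ n) ℤ.^ e ℤ.* + (N C j) ℤ.+ -1ℤ ℤ.* (+ (N C N) ℤ.* -1ℤ ℤ.^ e ℤ.* + (N C j)) ≡ 0ℤ)
    (sym (n∸n≡0 N)) (i+-1*i≡0 (+ (N C N) ℤ.* 1ℤ ℤ.* + (N C j)))

-- The difference `X` of the two sides has vanishing binomial moments for all j ≤ n.
numberWithHits≡closedForm : ∀ n k → k ≤ n → + (suc n ^ 2) ℤ.* + numberWithHits n k ≡ closedForm n k
numberWithHits≡closedForm n k k≤n =
  ℤ.i-j≡0⇒i≡j (+ (suc n ^ 2) ℤ.* + numberWithHits n k) (closedForm n k)
    (binomial-moments-zero (suc n) X moments k (s≤s k≤n))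
  where
  q = + (suc n ^ 2)

  X : ℕ → ℤ
  X k = q ℤ.* + numberWithHits n k ℤ.- closedForm n k

  distr : ∀ q a b c → (q ℤ.* a ℤ.- b) ℤ.* c ≡ q ℤ.* (a ℤ.* c) ℤ.+ -1ℤ ℤ.* (b ℤ.* c)
  distr = solve-∀ℤ

  moments : ∀ j → j < suc n → ∑ℤ (suc n) (λ k → X k ℤ.* + (k C j)) ≡ 0ℤ
  moments j j<1+n = begin
    ∑ℤ (suc n) (λ k → X k ℤ.* + (k C j))
      ≡⟨ ∑ℤ-cong (suc n) (λ k _ → trans (distr q (+ A k) (closedForm n k) (+ (k C j)))
           (cong (λ x → q ℤ.* x ℤ.+ -1ℤ ℤ.* (closedForm n k ℤ.* + (k C j))) (sym (ℤ.pos-* (A k) (k C j))))) ⟩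
    ∑ℤ (suc n) (λ k → q ℤ.* + (A k * (k C j)) ℤ.+ -1ℤ ℤ.* (closedForm n k ℤ.* + (k C j)))
      ≡⟨ ∑ℤ-+ (suc n) (λ k → q ℤ.* + (A k * (k C j))) (λ k → -1ℤ ℤ.* (closedForm n k ℤ.* + (k C j))) ⟩
    ∑ℤ (suc n) (λ k → q ℤ.* + (A k * (k C j))) ℤ.+ ∑ℤ (suc n) (λ k → -1ℤ ℤ.* (closedForm n k ℤ.* + (k C j)))
      ≡⟨ cong₂ ℤ._+_
           (trans (∑ℤ-* (suc n) q (λ k → + (A k * (k C j))))
             (trans (cong (q ℤ.*_) (∑ℤ-pos (suc n) (λ k → A k * (k C j))))
               (trans (sym (ℤ.pos-* (suc n ^ 2) _)) (cong +_ (scaled-moment j (s≤s⁻¹ j<1+n))))))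
           (trans (∑ℤ-* (suc n) -1ℤ (λ k → closedForm n k ℤ.* + (k C j)))
             (cong (-1ℤ ℤ.*_) (closedForm-moment j (s≤s⁻¹ j<1+n)))) ⟩
    M ℤ.+ -1ℤ ℤ.* M ≡⟨ i+-1*i≡0 M ⟩
    0ℤ ∎
    where
    A = numberWithHits n
    M = + ((suc n C j) * suc n ^ (suc n ∸ j))

-- Among unnormalised rationals each fraction keeps its written numerator and denominator, so the
-- claim becomes the cross-multiplied hypothesis.
/-clear-denominator : ∀ d .{{_ : NonZero d}} a b c → + d ℤ.* a ≡ b ℤ.* c →
  a / 1 ≡ (1ℤ / d) ℚ.* (b / 1) ℚ.* (c / 1)
/-clear-denominator (suc d) a b c eq = ℚ.toℚᵘ-injective (ℚᵘ.≃-trans (toℚᵘ-/ a 0) (ℚᵘ.≃-trans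
  (*≡* (trans (left a (+ suc d)) (trans eq (right b c))))
  (ℚᵘ.≃-sym (ℚᵘ.≃-trans (ℚ.toℚᵘ-homo-* ((1ℤ / suc d) ℚ.* (b / 1)) (c / 1))
    (ℚᵘ.*-cong (ℚᵘ.≃-trans (ℚ.toℚᵘ-homo-* (1ℤ / suc d) (b / 1))
      (ℚᵘ.*-cong (toℚᵘ-/ 1ℤ d) (toℚᵘ-/ b 0))) (toℚᵘ-/ c 0))))))
  where
  toℚᵘ-/ : ∀ p d → toℚᵘ (p / suc d) ℚᵘ.≃ mkℚᵘ p d
  toℚᵘ-/ p d = ℚ.toℚᵘ-fromℚᵘ (mkℚᵘ p d)

  left : ∀ a d → a ℤ.* (d ℤ.* 1ℤ ℤ.* 1ℤ) ≡ d ℤ.* a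
  left = solve-∀ℤ

  right : ∀ b c → b ℤ.* c ≡ 1ℤ ℤ.* b ℤ.* c ℤ.* 1ℤ
  right = solve-∀ℤ

theorem2p1 : ∀ (n k : ℕ) → 1 ≤ n → k ≤ n →
    ∃[ N ] (ParkingFunctionWithFixedPoints n k ↔ Fin N) ×
    ((+ N) / 1 ≡
    (1ℤ / (suc n ^ 2)) ℚ.* ((+ (suc n C k)) / 1) ℚ.*
    (((+ n) ℤ.^ (n ∸ k + 1) ℤ.- -1ℤ ℤ.^ (n ∸ k + 1)) / 1))
theorem2p1 n k _ k≤n = numberWithHits n k , parkingFunctions↔ n k ,
  /-clear-denominator (suc n ^ 2) (+ numberWithHits n k) (+ (suc n C k)) _ (numberWithHits≡closedForm n k k≤n)
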